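{- Let $G$ be a graph of order $n$ and minimum degree $\delta(G)$ such that $G \neq K_n$ and $G \neq K_n - M$, where $M$ is a perfect matching of $K_n$ (that is, $G$ is neither isomorphic to the complete graph $K_n$ nor to the graph obtained from $K_n$ by deleting the edges of a perfect matching). Then $rad_p(G) \leq n - \delta(G) - 1$.
   Context: All graphs are finite, simple, undirected and non-empty. For a graph $G$ and $S \subseteq V(G)$, define $P^1_G(S) = N[S]$ (the closed neighbourhood of $S$), and for $i \geq 1$ let $V^i = \{v \in P^i_G(S) : |N[v] \setminus P^i_G(S)| \leq 1\}$ and $P^{i+1}_G(S) = P^i_G(S) \cup N[V^i]$. The set $S$ is a power dominating set (PDS) of $G$ if $P^i_G(S) = V(G)$ for some $i \ge 1$. The power domination number $\gamma_p(G)$ is the minimum cardinality of a PDS of $G$. For a PDS $S$, $rad_p(G,S) = \min\{i \geq 1 : P^i_G(S) = V(G)\}$. The propagation radius of $G$ is $rad_p(G) = \min\{rad_p(G,S) : S \text{ is a PDS of } G \text{ with } |S| = \gamma_p(G)\}$. -}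

module Defs where

import Data.Bool.Properties as Bool
open import Data.Fin using (Fin; zero)
import Data.Fin.Properties as Fin
open import Data.Fin.Permutation using (Permutation; _⟨$⟩ʳ_)
open import Data.Fin.Subset
  using (Subset; _∈_; _⊆_; ⊤; ⁅_⁆; _∪_; _─_; ∣_∣)
open import Data.Fin.Subset.Properties
  using (_∈?_; _⊆?_; anySubset?; ∈⊤; ⊆⊤; ⊆-refl; ⊆-trans; ⊆-antisym; ∣p∣≤n;
         ∣p∣≡n⇒p≡⊤; p⊂q⇒∣p∣<∣q∣; p⊆p∪q; x∈⁅x⁆)
open import Data.Nat
  using (ℕ; zero; suc; _≤_; z≤n; s≤s; _≤?_; NonZero; _≤′_; ≤′-refl; ≤′-step)
import Data.Nat.Properties as ℕ
open import Data.Product using (∃; ∃!; ∃-syntax; Σ-syntax; _×_; _,_; proj₁; proj₂)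
open import Data.Sum using (_⊎_; inj₁; inj₂)
open import Data.Vec using (tabulate)
open import Data.Vec.Properties using (≡-dec; lookup∘tabulate; lookup⇒[]=)
open import Function using (_∘_)
open import Function.Bundles using (_⇔_)
open import Level using (Level; 0ℓ)
open import Relation.Binary using (Rel; Symmetric; Irreflexive)
  renaming (Decidable to Decidable₂)
open import Relation.Binary.PropositionalEquality
  using (_≡_; _≢_; refl; sym; trans; cong; subst; ≢-sym)
open import Relation.Nullary using (Dec; yes; no; does; ¬_; contradiction)
open import Relation.Nullary.Decidable using (map′; _×-dec_; ¬?; decidable-stable; dec-true)
open import Relation.Unary using (Pred; Decidable; Satisfiable)

private
  variable
    ℓ : Level
    m n : ℕ

------------------------------------------------------------------------
-- Minimum of a non-empty decidable set of natural numbers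

IsMinimum : Pred ℕ ℓ → Pred ℕ ℓ
IsMinimum P m = P m × (∀ {k} → P k → m ≤ k)

private
  search : {P : Pred ℕ ℓ} → Decidable P → ∀ k → P k → ∃ (IsMinimum P)
  search P? zero p = zero , p , λ _ → z≤n
  search {P = P} P? (suc k) p with P? zero
  ... | yes p₀ = zero , p₀ , λ _ → z≤n
  ... | no ¬p₀ with search (P? ∘ suc) k p
  ...   | m , pₘ , lower = suc m , pₘ , lower′
    where
    lower′ : ∀ {j} → P j → suc m ≤ j
    lower′ {zero}  p₀ = contradiction p₀ ¬p₀
    lower′ {suc j} pⱼ = s≤s (lower pⱼ)

minimum : {P : Pred ℕ ℓ} → Decidable P → Satisfiable P → ∃ (IsMinimum P)
minimum P? (k , p) = search P? k p

min : {P : Pred ℕ ℓ} → Decidable P → Satisfiable P → ℕ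
min P? ∃P = proj₁ (minimum P? ∃P)

min-isMinimum : {P : Pred ℕ ℓ} (P? : Decidable P) (∃P : Satisfiable P) →
                IsMinimum P (min P? ∃P)
min-isMinimum P? ∃P = proj₂ (minimum P? ∃P)

------------------------------------------------------------------------
-- Finite simple graphs on the vertex set Fin n

record Graph (n : ℕ) : Set₁ where
  field
    Adj        : Rel (Fin n) 0ℓ
    adj?       : Decidable₂ Adj
    adj-sym    : Symmetric Adj
    adj-irrefl : Irreflexive _≡_ Adj

open Graph public

infix 4 _≅_
infixl 6 _∖_

_≅_ : Graph m → Graph n → Set
_≅_ {m} {n} G H =
  Σ[ π ∈ Permutation m n ] (∀ u v → Adj G u v ⇔ Adj H (π ⟨$⟩ʳ u) (π ⟨$⟩ʳ v))

K : ∀ n → Graph n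
K n = record
  { Adj        = _≢_
  ; adj?       = λ u v → ¬? (u Fin.≟ v)
  ; adj-sym    = ≢-sym
  ; adj-irrefl = λ u≡v u≢v → u≢v u≡v
  }

-- Sets of edges are represented by graphs on the same vertex set; G ∖ M
-- keeps all vertices and deletes the edges of M.
_∖_ : Graph n → Graph n → Graph n
G ∖ M = record
  { Adj        = λ u v → Adj G u v × ¬ Adj M u v
  ; adj?       = λ u v → adj? G u v ×-dec ¬? (adj? M u v)
  ; adj-sym    = λ (uv , ¬uv) → adj-sym G uv , ¬uv ∘ adj-sym M
  ; adj-irrefl = λ u≡v (uv , _) → adj-irrefl G u≡v uv
  }

record IsPerfectMatching (G M : Graph n) : Set where
  field
    edges   : ∀ {u v} → Adj M u v → Adj G u v
    matched : ∀ u → ∃! _≡_ (Adj M u)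

------------------------------------------------------------------------
-- Neighbourhoods and degrees

⟪_⟫ : {P : Pred (Fin n) ℓ} → Decidable P → Subset n
⟪ P? ⟫ = tabulate (does ∘ P?)

∈⟪⟫⁺ : {P : Pred (Fin n) ℓ} (P? : Decidable P) → ∀ {v} → P v → v ∈ ⟪ P? ⟫
∈⟪⟫⁺ P? {v} p =
  lookup⇒[]= v _ (trans (lookup∘tabulate (does ∘ P?) v) (dec-true (P? v) p))

module _ (G : Graph n) where

  N⟨_⟩ : Fin n → Subset n
  N⟨ v ⟩ = ⟪ adj? G v ⟫

  N[_] : Fin n → Subset n
  N[ v ] = ⁅ v ⁆ ∪ N⟨ v ⟩

  dominated? : ∀ S → Decidable (λ w → ∃[ v ] v ∈ S × w ∈ N[ v ])
  dominated? S w = Fin.any? (λ v → (v ∈? S) ×-dec (w ∈? N[ v ]))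

  N[_]ˢ : Subset n → Subset n
  N[ S ]ˢ = ⟪ dominated? S ⟫

  deg : Fin n → ℕ
  deg v = ∣ N⟨ v ⟩ ∣

vertex : .{{_ : NonZero n}} → Fin n
vertex {suc _} = zero

δ : .{{_ : NonZero n}} → Graph n → ℕ
δ G = min (λ d → Fin.any? (λ v → deg G v ℕ.≟ d)) (deg G vertex , vertex , refl)

------------------------------------------------------------------------
-- Power domination

module _ (G : Graph n) where

  propagating : Subset n → Subset n
  propagating X = ⟪ (λ v → (v ∈? X) ×-dec (∣ N[_] G v ─ X ∣ ≤? 1)) ⟫

  step : Subset n → Subset n
  step X = X ∪ N[_]ˢ G (propagating X)

  -- The sequence of monitored sets starts at index 1. Index 0 is only a
  -- filler and is excluded wherever an index is quantified.
  P : Subset n → ℕ → Subset n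
  P S 0             = S
  P S 1             = N[_]ˢ G S
  P S (suc (suc i)) = step (P S (suc i))

  MonitorsAllAt : Subset n → Pred ℕ 0ℓ
  MonitorsAllAt S i = 1 ≤ i × P S i ≡ ⊤

  IsPDS : Pred (Subset n) 0ℓ
  IsPDS S = ∃ (MonitorsAllAt S)

  monitorsAllAt? : ∀ S → Decidable (MonitorsAllAt S)
  monitorsAllAt? S i = (1 ≤? i) ×-dec ≡-dec Bool._≟_ (P S i) ⊤

  -- Decidability of IsPDS: an increasing chain of subsets of an n-element
  -- set, each determined by its predecessor, is constant from index n on.
  private
    module _ (S : Subset n) where

      X : ℕ → Subset n
      X i = P S (suc i)

      X-mono′ : ∀ {i j} → i ≤′ j → X i ⊆ X j
      X-mono′ ≤′-refl       = ⊆-refl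
      X-mono′ (≤′-step i≤j) = ⊆-trans (X-mono′ i≤j) (p⊆p∪q _)

      X-grows : ∀ i → (i ≤ ∣ X i ∣) ⊎ (step (X i) ≡ X i)
      X-grows zero = inj₁ z≤n
      X-grows (suc i) with X-grows i
      ... | inj₂ fix = inj₂ (cong step fix)
      ... | inj₁ i≤∣X∣ with step (X i) ⊆? X i
      ...   | yes sub = inj₂ (cong step (⊆-antisym sub (p⊆p∪q _)))
      ...   | no ¬sub = inj₁ (ℕ.≤-<-trans i≤∣X∣ (p⊂q⇒∣p∣<∣q∣ (p⊆p∪q _ , new)))
        where
        new : ∃[ v ] v ∈ step (X i) × ¬ (v ∈ X i)
        new with Fin.any? (λ v → (v ∈? step (X i)) ×-dec ¬? (v ∈? X i))
        ... | yes ∃v = ∃v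
        ... | no ¬∃v = contradiction
          (λ {v} v∈ → decidable-stable (v ∈? X i) (λ v∉ → ¬∃v (v , v∈ , v∉))) ¬sub

      X-fixed : step (X n) ≡ X n → ∀ {j} → n ≤′ j → X j ≡ X n
      X-fixed fix ≤′-refl       = refl
      X-fixed fix (≤′-step n≤j) = trans (cong step (X-fixed fix n≤j)) fix

      X-stable : ∀ {k} → X k ≡ ⊤ → X n ≡ ⊤
      X-stable {k} Xk≡⊤ with X-grows n
      ... | inj₁ n≤ = ∣p∣≡n⇒p≡⊤ (ℕ.≤-antisym (∣p∣≤n (X n)) n≤)
      ... | inj₂ fix with ℕ.≤-total n k
      ...   | inj₁ n≤k = trans (sym (X-fixed fix (ℕ.≤⇒≤′ n≤k))) Xk≡⊤
      ...   | inj₂ k≤n = ⊆-antisym ⊆⊤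
        (subst (_⊆ X n) Xk≡⊤ (X-mono′ (ℕ.≤⇒≤′ k≤n)))

  isPDS? : Decidable IsPDS
  isPDS? S = map′ (suc n ,_) stable (monitorsAllAt? S (suc n))
    where
    stable : IsPDS S → MonitorsAllAt S (suc n)
    stable (suc k , _ , eq) = s≤s z≤n , X-stable S {k} eq

  ⊤-isPDS : IsPDS ⊤
  ⊤-isPDS = 1 , s≤s z≤n , ⊆-antisym ⊆⊤
    (λ {v} _ → ∈⟪⟫⁺ (dominated? G ⊤) (v , ∈⊤ , p⊆p∪q _ (x∈⁅x⁆ v)))

  PDSOfSize : Pred ℕ 0ℓ
  PDSOfSize k = ∃[ S ] IsPDS S × ∣ S ∣ ≡ k

  PDSOfSize? : Decidable PDSOfSize
  PDSOfSize? k = anySubset? (λ S → isPDS? S ×-dec (∣ S ∣ ℕ.≟ k))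

  somePDS : Satisfiable PDSOfSize
  somePDS = ∣ ⊤ {n} ∣ , ⊤ , ⊤-isPDS , refl

  γₚ : ℕ
  γₚ = min PDSOfSize? somePDS

  -- rad_p(G, S)
  radₚ[_] : ∀ S → IsPDS S → ℕ
  radₚ[ S ] pds = min (monitorsAllAt? S) pds

  -- The value does not depend on the proof that S is a PDS.
  radₚ[]-irrelevant : ∀ S (p q : IsPDS S) → radₚ[ S ] p ≡ radₚ[ S ] q
  radₚ[]-irrelevant S p q = ℕ.≤-antisym
    (proj₂ (min-isMinimum (monitorsAllAt? S) p)
      (proj₁ (min-isMinimum (monitorsAllAt? S) q)))
    (proj₂ (min-isMinimum (monitorsAllAt? S) q)
      (proj₁ (min-isMinimum (monitorsAllAt? S) p)))

  -- r = rad_p(G, S) for some PDS S of cardinality γ_p(G)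
  RadiusOfMinimumPDS : Pred ℕ 0ℓ
  RadiusOfMinimumPDS r = ∃[ S ] ∣ S ∣ ≡ γₚ × ∃[ pds ] radₚ[ S ] pds ≡ r

  radiusOfMinimumPDS? : Decidable RadiusOfMinimumPDS
  radiusOfMinimumPDS? r = anySubset? (λ S → (∣ S ∣ ℕ.≟ γₚ) ×-dec hasRadius? S)
    where
    hasRadius? : ∀ S → Dec (∃[ pds ] radₚ[ S ] pds ≡ r)
    hasRadius? S with isPDS? S
    ... | no ¬pds = no (¬pds ∘ proj₁)
    ... | yes pds = map′ (pds ,_)
      (λ (q , eq) → trans (radₚ[]-irrelevant S pds q) eq)
      (radₚ[ S ] pds ℕ.≟ r)

  minimumPDS-radius : Satisfiable RadiusOfMinimumPDS
  minimumPDS-radius =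
    let S , pds , ∣S∣≡γ = proj₁ (min-isMinimum PDSOfSize? somePDS)
    in  radₚ[ S ] pds , S , ∣S∣≡γ , pds , refl

  radₚ : ℕ
  radₚ = min radiusOfMinimumPDS? minimumPDS-radius

{-# OPTIONS --safe #-}
-- Put k = n - δ - 1. If k ≤ 1, counting non-neighbours shows that G is Kₙ or
-- Kₙ - M, or has a vertex of degree n - 1, which monitors G in one step.
-- Let k ≥ 2 and suppose that a minimum PDS S does not monitor G within k steps.
-- Then Pᵏ(S) has at most n - 1 = δ + k vertices, which forces P¹(S) = N[v] for
-- each v ∈ S, so {v} is a PDS, and every step adds exactly one vertex wᵢ,
-- forced by some fᵢ. The last vertex wₖ is not adjacent to v, f₁, …, fₖ₋₁, so by
-- its degree it is adjacent to all other vertices. A vertex outside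
-- {v, f₁, …, fₖ₋₁} that is not adjacent to wₖ₋₁ would therefore force wₖ
-- together with wₖ₋₁; hence N[wₖ₋₁] contains everything except v, f₁, …, fₖ₋₂.
-- Running the process backwards, wᵢ forces fᵢ for i = k - 2, …, 1 and finally f₁
-- forces v, so {wₖ₋₁} monitors G within k steps.
module Submission where

open import Defs
import Data.Bool.Properties as Bool
open import Data.Fin using (Fin; zero)
import Data.Fin.Permutation as Permutation
import Data.Fin.Properties as Fin
open import Data.Fin.Subset
  using (Subset; _∈_; _∉_; _⊆_; ⊤; ⁅_⁆; _∪_; _─_; ∁; ∣_∣; Nonempty)
open import Data.Fin.Subset.Properties
open import Data.Nat
  using (ℕ; zero; suc; _+_; _≤_; _<_; _∸_; z≤n; s≤s; s≤s⁻¹; _≤?_; NonZero)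
import Data.Nat.Properties as ℕ
open import Data.Product using (∃-syntax; _×_; _,_; proj₁; proj₂)
open import Data.Sum using (_⊎_; inj₁; inj₂; [_,_]′)
open import Data.Vec.Properties using (≡-dec; lookup∘tabulate; []=⇒lookup)
open import Function using (_∘_; case_of_)
open import Function.Bundles using (mk⇔)
open import Level using (Level)
open import Relation.Binary.PropositionalEquality
  using (_≡_; _≢_; refl; sym; trans; cong; subst; ≢-sym)
open import Relation.Nullary using (yes; no; does; ¬_; contradiction)
open import Relation.Nullary.Decidable using (¬?; _×-dec_; decidable-stable)
open import Relation.Unary using (Pred; Decidable)

private
  variable
    ℓ : Level
    n : ℕ
    p q : Subset n
    x y z : Fin n

-- Elements and cardinalities of finite subsets.

∈⟪⟫⁻ : {A : Pred (Fin n) ℓ} (A? : Decidable A) → x ∈ ⟪ A? ⟫ → A x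
∈⟪⟫⁻ {x = x} A? x∈ with A? x in eq
... | yes a = a
... | no ¬a = contradiction
  (trans (sym ([]=⇒lookup x∈))
    (trans (lookup∘tabulate (does ∘ A?) x) (cong does eq)))
  λ ()

x∈p─q⇒x∉q : x ∈ p ─ q → x ∉ q
x∈p─q⇒x∉q {x = x} {p = p} {q = q} x∈p─q x∈q =
  ⊂-irref (p─q─q≡p─q p q)
    (p∩q≢∅⇒p─q⊂p (p ─ q) q (x , x∈p∩q⁺ (x∈p─q , x∈q)))

x∈p⇒⁅x⁆⊆p : x ∈ p → ⁅ x ⁆ ⊆ p
x∈p⇒⁅x⁆⊆p {x = x} x∈p y∈⁅x⁆ with refl ← x∈⁅y⁆⇒x≡y x y∈⁅x⁆ = x∈p

x∉p⇒∣p∣<∣p∪⁅x⁆∣ : x ∉ p → ∣ p ∣ < ∣ p ∪ ⁅ x ⁆ ∣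
x∉p⇒∣p∣<∣p∪⁅x⁆∣ {x = x} {p = p} x∉p =
  p⊂q⇒∣p∣<∣q∣ (p⊆p∪q _ , x , q⊆p∪q p _ (x∈⁅x⁆ x) , x∉p)

p⊆q∧∣q∣≤∣p∣⇒q⊆p : p ⊆ q → ∣ q ∣ ≤ ∣ p ∣ → q ⊆ p
p⊆q∧∣q∣≤∣p∣⇒q⊆p {p = p} p⊆q ∣q∣≤∣p∣ {x} x∈q with x ∈? p
... | yes x∈p = x∈p
... | no x∉p = contradiction (p⊂q⇒∣p∣<∣q∣ (p⊆q , x , x∈q , x∉p)) (ℕ.≤⇒≯ ∣q∣≤∣p∣)

∣p∣≤1⇒y≡x : ∣ p ∣ ≤ 1 → x ∈ p → y ∈ p → y ≡ x
∣p∣≤1⇒y≡x {x = x} ∣p∣≤1 x∈p y∈p = x∈⁅y⁆⇒x≡y x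
  (p⊆q∧∣q∣≤∣p∣⇒q⊆p (x∈p⇒⁅x⁆⊆p x∈p)
    (ℕ.≤-trans ∣p∣≤1 (ℕ.≤-reflexive (sym (∣⁅x⁆∣≡1 x)))) y∈p)

∣p∣≤2⇒z≡x⊎z≡y : ∣ p ∣ ≤ 2 → x ∈ p → y ∈ p → x ≢ y → z ∈ p → z ≡ x ⊎ z ≡ y
∣p∣≤2⇒z≡x⊎z≡y {p = p} {x = x} {y = y} ∣p∣≤2 x∈p y∈p x≢y z∈p =
  [ inj₁ ∘ x∈⁅y⁆⇒x≡y x , inj₂ ∘ x∈⁅y⁆⇒x≡y y ]′
    (x∈p∪q⁻ ⁅ x ⁆ ⁅ y ⁆ (p⊆q∧∣q∣≤∣p∣⇒q⊆p pair⊆p (ℕ.≤-trans ∣p∣≤2 2≤∣pair∣) z∈p))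
  where
  pair⊆p : ⁅ x ⁆ ∪ ⁅ y ⁆ ⊆ p
  pair⊆p u∈ = [ x∈p⇒⁅x⁆⊆p x∈p , x∈p⇒⁅x⁆⊆p y∈p ]′ (x∈p∪q⁻ ⁅ x ⁆ ⁅ y ⁆ u∈)
  2≤∣pair∣ : 2 ≤ ∣ ⁅ x ⁆ ∪ ⁅ y ⁆ ∣
  2≤∣pair∣ = subst (_< ∣ ⁅ x ⁆ ∪ ⁅ y ⁆ ∣) (∣⁅x⁆∣≡1 x)
    (x∉p⇒∣p∣<∣p∪⁅x⁆∣ (x≢y⇒x∉⁅y⁆ (≢-sym x≢y)))

p≢⊤⇒∣p∣<n : {p : Subset n} → p ≢ ⊤ → ∣ p ∣ < n
p≢⊤⇒∣p∣<n {p = p} p≢⊤ = ℕ.≤∧≢⇒< (∣p∣≤n p) (p≢⊤ ∘ ∣p∣≡n⇒p≡⊤)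

full⇒≡⊤ : (∀ x → x ∈ p) → p ≡ ⊤
full⇒≡⊤ full = ⊆-antisym ⊆⊤ (λ {x} _ → full x)

p⊈q⇒∃∉ : ¬ (p ⊆ q) → ∃[ x ] x ∈ p × x ∉ q
p⊈q⇒∃∉ {p = p} {q = q} p⊈q with Fin.any? (λ x → (x ∈? p) ×-dec ¬? (x ∈? q))
... | yes ∃x = ∃x
... | no ¬∃x = contradiction
  (λ {x} x∈p → decidable-stable (x ∈? q) (λ x∉q → ¬∃x (x , x∈p , x∉q))) p⊈q

p≢⊤⇒∃∉ : p ≢ ⊤ → ∃[ x ] x ∉ p
p≢⊤⇒∃∉ p≢⊤ =
  let x , _ , x∉p = p⊈q⇒∃∉ (λ ⊤⊆p → p≢⊤ (⊆-antisym ⊆⊤ ⊤⊆p)) in x , x∉p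

module _ (G : Graph n) where

  private
    variable
      u v w : Fin n
      S T X Y : Subset n

  -- Closed neighbourhoods.

  ∈N[]⁻ : u ∈ N[_] G v → u ≡ v ⊎ Adj G v u
  ∈N[]⁻ {v = v} u∈ = [ inj₁ ∘ x∈⁅y⁆⇒x≡y v , inj₂ ∘ ∈⟪⟫⁻ (adj? G v) ]′
    (x∈p∪q⁻ ⁅ v ⁆ (N⟨_⟩ G v) u∈)

  v∈N[v] : ∀ v → v ∈ N[_] G v
  v∈N[v] v = p⊆p∪q _ (x∈⁅x⁆ v)

  adj⇒∈N[] : Adj G v u → u ∈ N[_] G v
  adj⇒∈N[] {v = v} vu = q⊆p∪q ⁅ v ⁆ (N⟨_⟩ G v) (∈⟪⟫⁺ (adj? G v) vu)

  N[]-sym : u ∈ N[_] G v → v ∈ N[_] G u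
  N[]-sym u∈ with ∈N[]⁻ u∈
  ... | inj₁ refl = u∈
  ... | inj₂ vu = adj⇒∈N[] (adj-sym G vu)

  deg<∣N[]∣ : ∀ v → deg G v < ∣ N[_] G v ∣
  deg<∣N[]∣ v = p⊂q⇒∣p∣<∣q∣
    (q⊆p∪q ⁅ v ⁆ _ , v , v∈N[v] v , λ v∈ → adj-irrefl G refl (∈⟪⟫⁻ (adj? G v) v∈))

  v∈S⇒N[v]⊆N[S] : v ∈ S → N[_] G v ⊆ N[_]ˢ G S
  v∈S⇒N[v]⊆N[S] {v = v} {S = S} v∈S w∈ = ∈⟪⟫⁺ (dominated? G S) (v , v∈S , w∈)

  N[⁅v⁆]⊆N[v] : N[_]ˢ G ⁅ v ⁆ ⊆ N[_] G v
  N[⁅v⁆]⊆N[v] {v = v} w∈ with ∈⟪⟫⁻ (dominated? G ⁅ v ⁆) w∈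
  ... | u , u∈ , w∈N[u] with refl ← x∈⁅y⁆⇒x≡y v u∈ = w∈N[u]

  -- Forcing and growth of the monitored sets.

  step-⊇ : X ⊆ step G X
  step-⊇ = p⊆p∪q _

  -- Places `N[_] G f ─ X` inside `⁅ w ⁆` pointwise; unlike a bound by 1 on its size, this names the
  -- forced vertex.
  Forces : Subset n → Fin n → Fin n → Set
  Forces X f w = f ∈ X × w ∈ N[_] G f × (∀ {u} → u ∈ N[_] G f → u ∉ X → u ≡ w)

  forces⇒∈step : ∀ {f} → Forces X f w → w ∈ step G X
  forces⇒∈step {X = X} {w = w} {f = f} (f∈X , w∈N[f] , only) =
    q⊆p∪q X _ (v∈S⇒N[v]⊆N[S]
      (∈⟪⟫⁺ (λ v → (v ∈? X) ×-dec (∣ N[_] G v ─ X ∣ ≤? 1)) (f∈X , small)) w∈N[f])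
    where
    small : ∣ N[_] G f ─ X ∣ ≤ 1
    small = ℕ.≤-trans
      (p⊆q⇒∣p∣≤∣q∣ (λ u∈ → subst (_∈ ⁅ w ⁆)
        (sym (only (p─q⊆p _ X u∈) (x∈p─q⇒x∉q u∈))) (x∈⁅x⁆ w)))
      (ℕ.≤-reflexive (∣⁅x⁆∣≡1 w))

  ∈step⇒forces : w ∈ step G X → w ∉ X → ∃[ f ] Forces X f w
  ∈step⇒forces {w = w} {X = X} w∈ w∉X with x∈p∪q⁻ X _ w∈
  ... | inj₁ w∈X = contradiction w∈X w∉X
  ... | inj₂ w∈N with ∈⟪⟫⁻ (dominated? G (propagating G X)) w∈N
  ...   | f , f∈prop , w∈N[f] =
    let f∈X , small = ∈⟪⟫⁻ (λ v → (v ∈? X) ×-dec (∣ N[_] G v ─ X ∣ ≤? 1)) f∈prop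
    in  f , f∈X , w∈N[f] , λ u∈ u∉X →
          ∣p∣≤1⇒y≡x small (x∈p∧x∉q⇒x∈p─q w∈N[f] w∉X) (x∈p∧x∉q⇒x∈p─q u∈ u∉X)

  -- A vertex outside `Y` is outside `X`, and whatever forces it from `X` has no further unmonitored
  -- neighbours relative to `Y`.
  step-mono : X ⊆ Y → step G X ⊆ step G Y
  step-mono {X = X} {Y = Y} X⊆Y {w} w∈ with w ∈? Y
  ... | yes w∈Y = step-⊇ w∈Y
  ... | no w∉Y =
    let f , f∈X , w∈N[f] , only = ∈step⇒forces w∈ (w∉Y ∘ X⊆Y)
    in  forces⇒∈step (X⊆Y f∈X , w∈N[f] , λ u∈ u∉Y → only u∈ (u∉Y ∘ X⊆Y))

  -- Comparing the sets at index 1 instead of `S` and `T` later lets one vertex of `S` stand for all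
  -- of `S`.
  P-mono : P G S 1 ⊆ P G T 1 → ∀ i → P G S (suc i) ⊆ P G T (suc i)
  P-mono S⊆T zero = S⊆T
  P-mono S⊆T (suc i) = step-mono (P-mono S⊆T i)

  P₁⊆P : ∀ i → P G S 1 ⊆ P G S (suc i)
  P₁⊆P zero = ⊆-refl
  P₁⊆P (suc i) = step-⊇ ∘ P₁⊆P i

  stalled : ∀ i → step G (P G S (suc i)) ⊆ P G S (suc i) →
            ∀ m → P G S (suc m) ⊆ P G S (suc i)
  stalled i fix zero = P₁⊆P i
  stalled i fix (suc m) = fix ∘ step-mono (stalled i fix m)

  -- A step that adds nothing would leave the process stuck for good, and `S` would never monitor
  -- all of `G`.
  P-increases : IsPDS G S → ∀ i → P G S (suc i) ≢ ⊤ →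
                ∃[ w ] w ∈ P G S (suc (suc i)) × w ∉ P G S (suc i)
  P-increases {S = S} (suc m , _ , eq) i Pᵢ≢⊤ = p⊈q⇒∃∉
    λ fix → Pᵢ≢⊤ (⊆-antisym ⊆⊤ (subst (_⊆ P G S (suc i)) eq (stalled i fix m)))

  P-suc≢⊤ : ∀ i → P G S (suc (suc i)) ≢ ⊤ → P G S (suc i) ≢ ⊤
  P-suc≢⊤ {S = S} i Pᵢ₊₁≢⊤ Pᵢ≡⊤ =
    Pᵢ₊₁≢⊤ (⊆-antisym ⊆⊤ (subst (_⊆ P G S (suc (suc i))) Pᵢ≡⊤ (step-⊇ {X = P G S (suc i)})))

  ∣P₁∣+i≤∣P∣ : IsPDS G S → ∀ i → P G S (suc i) ≢ ⊤ →
              ∣ P G S 1 ∣ + i ≤ ∣ P G S (suc i) ∣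
  ∣P₁∣+i≤∣P∣ pds zero _ = ℕ.≤-reflexive (ℕ.+-identityʳ _)
  ∣P₁∣+i≤∣P∣ {S = S} pds (suc i) Pᵢ₊₁≢⊤ =
    let Pᵢ≢⊤ = P-suc≢⊤ i Pᵢ₊₁≢⊤
        w , w∈ , w∉ = P-increases pds i Pᵢ≢⊤
    in  subst (_≤ ∣ P G S (suc (suc i)) ∣) (sym (ℕ.+-suc _ i))
          (ℕ.≤-<-trans (∣P₁∣+i≤∣P∣ pds i Pᵢ≢⊤) (p⊂q⇒∣p∣<∣q∣ (step-⊇ , w , w∈ , w∉)))

  -- Bounding the propagation radius by one set.

  radₚ≤ : ∀ {k} → ∣ S ∣ ≡ γₚ G → MonitorsAllAt G S k → radₚ G ≤ k
  radₚ≤ {S = S} {k = k} ∣S∣≡γ monitors = ℕ.≤-trans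
    (proj₂ (min-isMinimum (radiusOfMinimumPDS? G) (minimumPDS-radius G))
      (S , ∣S∣≡γ , (k , monitors) , refl))
    (proj₂ (min-isMinimum (monitorsAllAt? G S) (k , monitors)) monitors)

  P-nonempty⁻ : ∀ i → Nonempty (P G S (suc i)) → Nonempty S
  P-nonempty⁻ {S = S} zero (w , w∈) =
    let v , v∈S , _ = ∈⟪⟫⁻ (dominated? G S) w∈ in v , v∈S
  P-nonempty⁻ {S = S} (suc i) (w , w∈) with w ∈? P G S (suc i)
  ... | yes w∈Pᵢ = P-nonempty⁻ i (w , w∈Pᵢ)
  ... | no w∉Pᵢ =
    let f , f∈Pᵢ , _ = ∈step⇒forces w∈ w∉Pᵢ in P-nonempty⁻ i (f , f∈Pᵢ)

  PDS-nonempty : Fin n → IsPDS G S → Nonempty S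
  PDS-nonempty v (suc i , _ , eq) = P-nonempty⁻ i (v , subst (v ∈_) (sym eq) ∈⊤)

  minimumPDS : PDSOfSize G (γₚ G)
  minimumPDS = proj₁ (min-isMinimum (PDSOfSize? G) (somePDS G))

  -- Monitored vertices trace back to some element of the PDS, so no PDS is empty and a one-element
  -- PDS is minimum.
  singleton-radₚ≤ : ∀ {k} → MonitorsAllAt G ⁅ v ⁆ k → radₚ G ≤ k
  singleton-radₚ≤ {v = v} {k = k} monitors =
    radₚ≤ (ℕ.≤-antisym (ℕ.≤-trans (ℕ.≤-reflexive (∣⁅x⁆∣≡1 v)) 1≤γ) γ≤1) monitors
    where
    γ≤1 : γₚ G ≤ ∣ ⁅ v ⁆ ∣
    γ≤1 = proj₂ (min-isMinimum (PDSOfSize? G) (somePDS G)) (⁅ v ⁆ , (k , monitors) , refl)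
    1≤γ : 1 ≤ γₚ G
    1≤γ = let S , pds , ∣S∣≡γ = minimumPDS
              s , s∈S = PDS-nonempty v pds
          in  subst (1 ≤_) ∣S∣≡γ
                (subst (_≤ ∣ S ∣) (∣⁅x⁆∣≡1 s) (p⊆q⇒∣p∣≤∣q∣ (x∈p⇒⁅x⁆⊆p s∈S)))

  universal⇒radₚ≤1 : N[_] G v ≡ ⊤ → radₚ G ≤ 1
  universal⇒radₚ≤1 {v = v} N[v]≡⊤ = singleton-radₚ≤
    (s≤s z≤n , full⇒≡⊤ λ w →
      v∈S⇒N[v]⊆N[S] (x∈⁅x⁆ v) (subst (w ∈_) (sym N[v]≡⊤) ∈⊤))

  -- Reversing the propagation.

  -- Once everything outside Q is monitored, the rest is within i further steps.
  Reverses : Subset n → ℕ → Set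
  Reverses Q i = ∀ T m → (∀ {u} → u ∉ Q → u ∈ P G T (suc m)) →
                 ∀ u → u ∈ P G T (suc (m + i))

  -- For X = Pⁱ({v}), Q is the set {v, f₁, …, fᵢ₋₁}.
  record Chain (X : Subset n) (i : ℕ) : Set where
    field
      Q        : Subset n
      size     : i ≤ ∣ Q ∣
      closed   : u ∈ N[_] G v → v ∈ Q → u ∈ X
      reverses : Reverses Q i

  open Chain

  -- By `closed`, neighbours of the old `Q` lie in `X`, which misses `w`. Hence `f` is new to `Q`
  -- and is the only vertex of the enlarged set next to `w`. So `w` forces `f` back, and the
  -- reversal for the old `Q` takes over.
  extend : ∀ {f i} → Chain X i → w ∉ X → Forces X f w → Chain (step G X) (suc i)
  extend {X = X} {w = w} {f = f} {i = i} c w∉X F@(f∈X , w∈N[f] , only) = record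
    { Q        = Q c ∪ ⁅ f ⁆
    ; size     = ℕ.≤-<-trans (size c) (x∉p⇒∣p∣<∣p∪⁅x⁆∣ (w∉X ∘ closed c w∈N[f]))
    ; closed   = closed′
    ; reverses = reverses′
    }
    where
    N[f]⊆ : u ∈ N[_] G f → u ∈ step G X
    N[f]⊆ {u} u∈ with u ∈? X
    ... | yes u∈X = step-⊇ u∈X
    ... | no u∉X = subst (_∈ step G X) (sym (only u∈ u∉X)) (forces⇒∈step F)
    closed′ : u ∈ N[_] G v → v ∈ Q c ∪ ⁅ f ⁆ → u ∈ step G X
    closed′ u∈ v∈ with x∈p∪q⁻ (Q c) ⁅ f ⁆ v∈
    ... | inj₁ v∈Q = step-⊇ (closed c u∈ v∈Q)
    ... | inj₂ v∈⁅f⁆ with refl ← x∈⁅y⁆⇒x≡y f v∈⁅f⁆ = N[f]⊆ u∈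
    reverses′ : Reverses (Q c ∪ ⁅ f ⁆) (suc i)
    reverses′ T m Y⊇ u = subst (λ j → u ∈ P G T (suc j)) (sym (ℕ.+-suc m i))
      (reverses c T (suc m) next u)
      where
      w∉Q∪⁅f⁆ : w ∉ Q c ∪ ⁅ f ⁆
      w∉Q∪⁅f⁆ w∈ = [ (λ w∈Q → w∉X (closed c (v∈N[v] w) w∈Q))
                   , (λ w∈⁅f⁆ → w∉X (x∈p⇒⁅x⁆⊆p f∈X w∈⁅f⁆)) ]′ (x∈p∪q⁻ (Q c) ⁅ f ⁆ w∈)
      f-last : x ∈ N[_] G w → x ∉ P G T (suc m) → x ≡ f
      f-last {x} x∈ x∉ with x ∈? (Q c ∪ ⁅ f ⁆)
      ... | no x∉Q∪ = contradiction (Y⊇ x∉Q∪) x∉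
      ... | yes x∈Q∪ =
        [ (λ x∈Q → contradiction (closed c (N[]-sym x∈) x∈Q) w∉X) , x∈⁅y⁆⇒x≡y f ]′
          (x∈p∪q⁻ (Q c) ⁅ f ⁆ x∈Q∪)
      next : x ∉ Q c → x ∈ P G T (suc (suc m))
      next {x} x∉Q with x Fin.≟ f
      ... | yes refl = forces⇒∈step (Y⊇ w∉Q∪⁅f⁆ , N[]-sym w∈N[f] , f-last)
      ... | no x≢f = step-⊇ (Y⊇ ([ x∉Q , x≢y⇒x∉⁅y⁆ x≢f ]′ ∘ x∈p∪q⁻ (Q c) ⁅ f ⁆))

  chain : IsPDS G ⁅ v ⁆ → ∀ i → P G ⁅ v ⁆ (suc i) ≢ ⊤ → Chain (P G ⁅ v ⁆ (suc i)) (suc i)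
  chain {v = v} pds zero P₁≢⊤ = record
    { Q        = ⁅ v ⁆
    ; size     = ℕ.≤-reflexive (sym (∣⁅x⁆∣≡1 v))
    ; closed   = λ {u} u∈ x∈ → v∈S⇒N[v]⊆N[S] x∈ u∈
    ; reverses = reverses₁
    }
    where
    reverses₁ : Reverses ⁅ v ⁆ 1
    -- Only `v` can be missing. The vertex `f` forcing a vertex into index 2 is a neighbour of `v`,
    -- so it can force `v` back.
    reverses₁ T m Y⊇ u with P-increases pds zero P₁≢⊤
    ... | w , w∈ , w∉P₁ with ∈step⇒forces w∈ w∉P₁
    ...   | f , f∈P₁ , w∈N[f] , _ =
      subst (λ j → u ∈ P G T (suc j)) (ℕ.+-comm 1 m) (covers u)
      where
      f≢v : f ≢ v
      f≢v refl = w∉P₁ (v∈S⇒N[v]⊆N[S] (x∈⁅x⁆ v) w∈N[f])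
      covers : ∀ u → u ∈ P G T (suc (suc m))
      covers u with u Fin.≟ v
      ... | no u≢v = step-⊇ (Y⊇ (x≢y⇒x∉⁅y⁆ u≢v))
      ... | yes refl = forces⇒∈step
        ( Y⊇ (x≢y⇒x∉⁅y⁆ f≢v) , N[]-sym (N[⁅v⁆]⊆N[v] f∈P₁)
        , λ {x} _ x∉ → decidable-stable (x Fin.≟ v) (x∉ ∘ Y⊇ ∘ x≢y⇒x∉⁅y⁆) )
  chain pds (suc i) Pᵢ₊₁≢⊤ =
    let Pᵢ≢⊤ = P-suc≢⊤ i Pᵢ₊₁≢⊤
        w , w∈ , w∉ = P-increases pds i Pᵢ≢⊤
        f , F = ∈step⇒forces w∈ w∉
    in  extend (chain pds i Pᵢ≢⊤) w∉ F

  -- The case k = 2 + j, with `d` in the role of δ(G).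

  module _ {d j : ℕ} (d≤deg : ∀ v → d ≤ deg G v) (n≡ : n ≡ 3 + j + d) where

    d<∣P₁∣ : v ∈ S → d < ∣ P G S 1 ∣
    d<∣P₁∣ {v = v} v∈S = ℕ.≤-trans (ℕ.≤-<-trans (d≤deg v) (deg<∣N[]∣ v))
      (p⊆q⇒∣p∣≤∣q∣ (v∈S⇒N[v]⊆N[S] v∈S))

    -- In the notation above, X = Pᵏ⁻¹({v}), f = fₖ₋₁, w = wₖ₋₁ and z = wₖ.
    N[w]⊇∁Q : ∀ {f z} (c : Chain X (suc j)) → suc d + j ≤ ∣ X ∣ →
              Forces X f w → w ∉ X → z ∉ step G X →
              ∀ {u} → u ∉ Q c → u ∈ N[_] G w
    N[w]⊇∁Q {X = X} {w = w} {f = f} {z = z} c 1+d+j≤∣X∣ F@(f∈X , w∈N[f] , only)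
            w∉X z∉stepX = covers
      where
      z∉X : z ∉ X
      z∉X = z∉stepX ∘ step-⊇
      w≢z : w ≢ z
      w≢z refl = z∉stepX (forces⇒∈step F)

      ∣∁X∣≤2 : ∣ ∁ X ∣ ≤ 2
      ∣∁X∣≤2 = begin
        ∣ ∁ X ∣                       ≡⟨ ∣∁p∣≡n∸∣p∣ X ⟩
        n ∸ ∣ X ∣                     ≤⟨ ℕ.∸-monoʳ-≤ n 1+d+j≤∣X∣ ⟩
        n ∸ (suc d + j)               ≡⟨ cong (_∸ (suc d + j)) n≡2+ ⟩
        2 + (suc d + j) ∸ (suc d + j) ≡⟨ ℕ.m+n∸n≡m 2 (suc d + j) ⟩
        2                             ∎
        where
        open ℕ.≤-Reasoning
        n≡2+ : n ≡ 2 + (suc d + j)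
        n≡2+ = trans n≡ (cong (3 +_) (ℕ.+-comm j d))

      ∉X⇒ : u ∉ X → u ≡ w ⊎ u ≡ z
      ∉X⇒ u∉X =
        ∣p∣≤2⇒z≡x⊎z≡y ∣∁X∣≤2 (x∉p⇒x∈∁p w∉X) (x∉p⇒x∈∁p z∉X) w≢z (x∉p⇒x∈∁p u∉X)

      -- `R` collects `z` and v, f₁, ..., fₖ₋₁, none of them adjacent to `z`. Its size is at least n
      -- - d, so the degree of `z` leaves no other non-neighbours.
      R = (Q c ∪ ⁅ f ⁆) ∪ ⁅ z ⁆

      ∉R⁺ : u ∉ Q c → u ≢ f → u ≢ z → u ∉ R
      ∉R⁺ u∉Q u≢f u≢z u∈R with x∈p∪q⁻ (Q c ∪ ⁅ f ⁆) ⁅ z ⁆ u∈R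
      ... | inj₂ u∈⁅z⁆ = u≢z (x∈⁅y⁆⇒x≡y z u∈⁅z⁆)
      ... | inj₁ u∈ = [ u∉Q , x≢y⇒x∉⁅y⁆ u≢f ]′ (x∈p∪q⁻ (Q c) ⁅ f ⁆ u∈)

      f∉Q : f ∉ Q c
      f∉Q = w∉X ∘ closed c w∈N[f]
      z∉Q∪⁅f⁆ : z ∉ Q c ∪ ⁅ f ⁆
      z∉Q∪⁅f⁆ z∈ = [ (λ z∈Q → z∉X (closed c (v∈N[v] z) z∈Q))
                   , (λ z∈⁅f⁆ → z∉X (x∈p⇒⁅x⁆⊆p f∈X z∈⁅f⁆)) ]′ (x∈p∪q⁻ (Q c) ⁅ f ⁆ z∈)

      ∣R∣≥ : 3 + j ≤ ∣ R ∣
      ∣R∣≥ = ℕ.≤-<-trans (ℕ.≤-<-trans (size c) (x∉p⇒∣p∣<∣p∪⁅x⁆∣ f∉Q))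
        (x∉p⇒∣p∣<∣p∪⁅x⁆∣ z∉Q∪⁅f⁆)

      N⟨z⟩⊆∁R : N⟨_⟩ G z ⊆ ∁ R
      N⟨z⟩⊆∁R {u} u∈ = x∉p⇒x∈∁p (∉R⁺
        (λ u∈Q → z∉X (closed c z∈N[u] u∈Q))
        (λ { refl → w≢z (sym (only z∈N[u] z∉X)) })
        (λ { refl → adj-irrefl G refl zu }))
        where
        zu : Adj G z u
        zu = ∈⟪⟫⁻ (adj? G z) u∈
        z∈N[u] : z ∈ N[_] G u
        z∈N[u] = adj⇒∈N[] (adj-sym G zu)

      ∁R⊆N⟨z⟩ : ∁ R ⊆ N⟨_⟩ G z
      ∁R⊆N⟨z⟩ = p⊆q∧∣q∣≤∣p∣⇒q⊆p N⟨z⟩⊆∁R (begin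
        ∣ ∁ R ∣             ≡⟨ ∣∁p∣≡n∸∣p∣ R ⟩
        n ∸ ∣ R ∣           ≤⟨ ℕ.∸-monoʳ-≤ n ∣R∣≥ ⟩
        n ∸ (3 + j)         ≡⟨ cong (_∸ (3 + j)) n≡ ⟩
        3 + j + d ∸ (3 + j) ≡⟨ ℕ.m+n∸m≡n (3 + j) d ⟩
        d                   ≤⟨ d≤deg z ⟩
        deg G z             ∎)
        where open ℕ.≤-Reasoning

      z-adj : u ∉ Q c → u ≢ f → u ≢ z → Adj G z u
      z-adj u∉Q u≢f u≢z = ∈⟪⟫⁻ (adj? G z) (∁R⊆N⟨z⟩ (x∉p⇒x∈∁p (∉R⁺ u∉Q u≢f u≢z)))

      w-adj-z : Adj G z w
      w-adj-z = z-adj (w∉X ∘ closed c (v∈N[v] w)) (λ w≡f → w∉X (subst (_∈ X) (sym w≡f) f∈X)) w≢z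

      covers : u ∉ Q c → u ∈ N[_] G w
      covers {u} u∉Q with u Fin.≟ f | u ∈? X
      ... | yes refl | _ = N[]-sym w∈N[f]
      ... | no _ | no u∉X with ∉X⇒ u∉X
      ...   | inj₁ refl = v∈N[v] w
      ...   | inj₂ refl = N[]-sym (adj⇒∈N[] w-adj-z)
      -- Were `u` not adjacent to `w`, its only unmonitored neighbour would be `z`, and `u` would
      -- force `z` in the same step in which `f` forces `w`.
      covers {u} u∉Q | no u≢f | yes u∈X = decidable-stable (u ∈? N[_] G w) λ u∉N[w] →
        z∉stepX (forces⇒∈step
          ( u∈X
          , adj⇒∈N[] (adj-sym G (z-adj u∉Q u≢f (λ u≡z → z∉X (subst (_∈ X) u≡z u∈X))))
          , λ x∈N[u] x∉X → case ∉X⇒ x∉X of λ where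
              (inj₁ refl) → contradiction (N[]-sym x∈N[u]) u∉N[w]
              (inj₂ x≡z) → x≡z ))

    singletonPDS⇒radₚ≤ : IsPDS G ⁅ v ⁆ → radₚ G ≤ 2 + j
    singletonPDS⇒radₚ≤ {v = v} pds with ≡-dec Bool._≟_ (P G ⁅ v ⁆ (2 + j)) ⊤
    ... | yes eq = singleton-radₚ≤ (s≤s z≤n , eq)
    ... | no Pₖ≢⊤ =
      let Pₖ₋₁≢⊤ = P-suc≢⊤ j Pₖ≢⊤
          c = chain pds j Pₖ₋₁≢⊤
          w , w∈ , w∉ = P-increases pds j Pₖ₋₁≢⊤
          f , F = ∈step⇒forces w∈ w∉
          z , z∉ = p≢⊤⇒∃∉ Pₖ≢⊤
          large = ℕ.≤-trans (ℕ.+-monoˡ-≤ j (d<∣P₁∣ (x∈⁅x⁆ v))) (∣P₁∣+i≤∣P∣ pds j Pₖ₋₁≢⊤)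
      -- Index 1 covers the complement of `Q c`, and the reversal takes `suc j` further steps, which
      -- gives `2 + j`.
      in  singleton-radₚ≤ (s≤s z≤n , full⇒≡⊤ (reverses c ⁅ w ⁆ 0
            (v∈S⇒N[v]⊆N[S] (x∈⁅x⁆ w) ∘ N[w]⊇∁Q c large F w∉ z∉)))

    -- If `S` is too slow, then |P¹(S)| + (j + 1) ≤ n - 1 = d + j + 2. So P¹(S) has at most d + 1
    -- vertices, no more than the set N[v] it contains for v in `S`. The two sets coincide, and {v}
    -- monitors whatever `S` does.
    minimumPDS⇒radₚ≤ : IsPDS G S → ∣ S ∣ ≡ γₚ G → radₚ G ≤ 2 + j
    minimumPDS⇒radₚ≤ {S = S} pds ∣S∣≡γ with ≡-dec Bool._≟_ (P G S (2 + j)) ⊤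
    ... | yes eq = radₚ≤ ∣S∣≡γ (s≤s z≤n , eq)
    ... | no Pₖ≢⊤ = singletonPDS⇒radₚ≤ (singletonPDS pds)
      where
      member = PDS-nonempty (subst Fin (sym n≡) zero) pds
      v′ = proj₁ member
      v′∈S = proj₂ member
      ∣P₁∣≤1+d : ∣ P G S 1 ∣ ≤ suc d
      ∣P₁∣≤1+d = ℕ.+-cancelʳ-≤ (suc j) _ _ (begin
        ∣ P G S 1 ∣ + suc j  ≤⟨ ∣P₁∣+i≤∣P∣ pds (suc j) Pₖ≢⊤ ⟩
        ∣ P G S (2 + j) ∣    ≤⟨ s≤s⁻¹ (subst (∣ P G S (2 + j) ∣ <_) n≡ (p≢⊤⇒∣p∣<n Pₖ≢⊤)) ⟩
        suc (suc (j + d))    ≡⟨ cong (suc ∘ suc) (ℕ.+-comm j d) ⟩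
        suc (suc (d + j))    ≡⟨ cong suc (sym (ℕ.+-suc d j)) ⟩
        suc d + suc j        ∎)
        where open ℕ.≤-Reasoning
      P₁S⊆P₁v : P G S 1 ⊆ P G ⁅ v′ ⁆ 1
      P₁S⊆P₁v = v∈S⇒N[v]⊆N[S] (x∈⁅x⁆ v′) ∘ p⊆q∧∣q∣≤∣p∣⇒q⊆p (v∈S⇒N[v]⊆N[S] v′∈S)
        (ℕ.≤-trans ∣P₁∣≤1+d (ℕ.≤-<-trans (d≤deg v′) (deg<∣N[]∣ v′)))
      singletonPDS : IsPDS G S → IsPDS G ⁅ v′ ⁆
      singletonPDS (suc i , 1≤ , eq) =
        suc i , 1≤ , ⊆-antisym ⊆⊤ (subst (_⊆ P G ⁅ v′ ⁆ (suc i)) eq (P-mono P₁S⊆P₁v i))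

    radₚ≤2+j : radₚ G ≤ 2 + j
    radₚ≤2+j = let _ , pds , ∣S∣≡γ = minimumPDS in minimumPDS⇒radₚ≤ pds ∣S∣≡γ

  -- Complete graphs and deleted perfect matchings.

  complete : (∀ v → N[_] G v ≡ ⊤) → G ≅ K n
  complete N≡⊤ = Permutation.id , λ u v → mk⇔
    (λ uv u≡v → adj-irrefl G u≡v uv)
    (λ u≢v → [ (λ v≡u → contradiction (sym v≡u) u≢v) , (λ uv → uv) ]′
      (∈N[]⁻ (subst (v ∈_) (sym (N≡⊤ u)) ∈⊤)))

  -- The complement of `G`, serving as the candidate for the matching.
  nonadjacency : Graph n
  nonadjacency = K n ∖ G

  G≅K∖nonadjacency : G ≅ (K n ∖ nonadjacency)
  G≅K∖nonadjacency = Permutation.id , λ u v → mk⇔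
    (λ uv → (λ u≡v → adj-irrefl G u≡v uv) , λ (_ , ¬uv) → ¬uv uv)
    (λ (u≢v , ¬¬uv) → decidable-stable (adj? G u v) (λ ¬uv → ¬¬uv (u≢v , ¬uv)))

  -- Each closed neighbourhood misses at least one vertex and at most one, so every vertex has a
  -- unique partner in the complement.
  nonadjacency-matching : (∀ v → N[_] G v ≢ ⊤) → (∀ v → n ≤ suc ∣ N[_] G v ∣) →
                          IsPerfectMatching (K n) nonadjacency
  nonadjacency-matching N≢⊤ n≤ = record
    { edges   = proj₁
    ; matched = λ u →
        let w , w∉ = p≢⊤⇒∃∉ (N≢⊤ u)
        in  w
          , ((λ u≡w → w∉ (subst (_∈ N[_] G u) u≡w (v∈N[v] u))) , w∉ ∘ adj⇒∈N[])
          , λ (u≢y , ¬uy) → ∣p∣≤1⇒y≡x (small u)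
              (x∉p⇒x∈∁p ([ u≢y ∘ sym , ¬uy ]′ ∘ ∈N[]⁻)) (x∉p⇒x∈∁p w∉)
    }
    where
    small : ∀ u → ∣ ∁ (N[_] G u) ∣ ≤ 1
    small u = ℕ.≤-trans (ℕ.≤-reflexive (∣∁p∣≡n∸∣p∣ (N[_] G u)))
      (ℕ.m≤n+o⇒m∸n≤o n ∣ N[_] G u ∣ (subst (n ≤_) (ℕ.+-comm 1 _) (n≤ u)))

-- Case distinction on n - δ(G) - 1.

δ≤deg : .{{_ : NonZero n}} (G : Graph n) → ∀ v → δ G ≤ deg G v
δ≤deg G v = proj₂ (min-isMinimum (λ d → Fin.any? (λ v → deg G v ℕ.≟ d))
  (deg G vertex , vertex , refl)) (v , refl)

theorem3p3 : ∀ {n : ℕ} .{{_ : NonZero n}} (G : Graph n) →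
    ¬ (G ≅ K n) →
    (∀ (M : Graph n) → IsPerfectMatching (K n) M → ¬ (G ≅ (K n ∖ M))) →
    radₚ G ≤ n ∸ δ G ∸ 1
theorem3p3 {n} G G≇K G≇K∖M with n ∸ δ G ∸ 1 in eq
-- Truncated subtraction yields only `n ≤ suc (δ G)`, which suffices to make every closed
-- neighbourhood the whole vertex set.
... | zero = contradiction (complete G N≡⊤) G≇K
  where
  N≡⊤ : ∀ v → N[_] G v ≡ ⊤
  N≡⊤ v = ∣p∣≡n⇒p≡⊤ {p = N[_] G v} (ℕ.≤-antisym (∣p∣≤n (N[_] G v)) (ℕ.≤-trans n≤1+δ
    (ℕ.≤-<-trans (δ≤deg G v) (deg<∣N[]∣ G v))))
    where
    n≤1+δ : n ≤ suc (δ G)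
    n≤1+δ = subst (n ≤_) (ℕ.+-comm (δ G) 1)
      (ℕ.m∸n≡0⇒m≤n (trans (sym (ℕ.∸-+-assoc n (δ G) 1)) eq))
... | suc zero with Fin.any? (λ v → ≡-dec Bool._≟_ (N[_] G v) ⊤)
...   | yes (v , N[v]≡⊤) = universal⇒radₚ≤1 G N[v]≡⊤
...   | no ∄universal = contradiction (G≅K∖nonadjacency G) (G≇K∖M (nonadjacency G)
        (nonadjacency-matching G (λ v N[v]≡⊤ → ∄universal (v , N[v]≡⊤)) λ v →
          ℕ.≤-trans n≤2+δ (s≤s (ℕ.≤-<-trans (δ≤deg G v) (deg<∣N[]∣ G v)))))
  where
  n≤2+δ : n ≤ 2 + δ G
  n≤2+δ = ℕ.≤-trans (ℕ.m≤n+m∸n n (δ G + 1)) (ℕ.≤-reflexive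
    (trans (cong (δ G + 1 +_) (trans (sym (ℕ.∸-+-assoc n (δ G) 1)) eq))
      (trans (ℕ.+-assoc (δ G) 1 1) (ℕ.+-comm (δ G) 2))))
theorem3p3 {n} G G≇K G≇K∖M | suc (suc j) = radₚ≤2+j G (δ≤deg G) n≡
  where
  eq′ : n ∸ suc (δ G) ≡ 2 + j
  eq′ = trans (cong (n ∸_) (ℕ.+-comm 1 (δ G))) (trans (sym (ℕ.∸-+-assoc n (δ G) 1)) eq)
  n≡ : n ≡ 3 + j + δ G
  -- The difference is `2 + j`, hence nonzero, so the subtraction is not truncated and can be
  -- undone.
  n≡ = trans (sym (ℕ.m∸n+n≡m {n} {suc (δ G)} (ℕ.<⇒≤ (ℕ.m∸n≢0⇒n<m λ eq₀ →
         contradiction (trans (sym eq′) eq₀) λ ()))))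
       (trans (cong (_+ suc (δ G)) eq′) (ℕ.+-suc (2 + j) (δ G)))
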